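{- Let $\mathbb X$ and $\mathbb Y$ be structures of the same relational language. Then (a) $\mathbb X\cong\mathbb Y\;\Rightarrow\;\mathbb P(\mathbb X)\cong\mathbb P(\mathbb Y)$; (b) $\mathbb X\rightleftarrows\mathbb Y\;\Rightarrow\;\operatorname{ro}\operatorname{sq}\mathbb P(\mathbb X)\cong\operatorname{ro}\operatorname{sq}\mathbb P(\mathbb Y)$.
   Context: For a relational language $L=\langle R_i:i\in I\rangle$ with arities $n_i\ge1$, an $L$-structure is $\mathbb X=\langle X,\langle\rho_i:i\in I\rangle\rangle$ with $X\neq\emptyset$, $\rho_i\subset X^{n_i}$. An embedding $f:\mathbb X\hookrightarrow\mathbb Y=\langle Y,\langle\sigma_i:i\in I\rangle\rangle$ is an injection $f:X\to Y$ with $\langle x_1,\dots,x_{n_i}\rangle\in\rho_i\Leftrightarrow\langle f(x_1),\dots,f(x_{n_i})\rangle\in\sigma_i$ for all $i\in I$ and all $x_1,\dots,x_{n_i}\in X$. $\mathbb X\cong\mathbb Y$ means there is a surjective embedding; $\mathbb X\rightleftarrows\mathbb Y$ (equimorphic) means each embeds in the other. $\mathbb P(\mathbb X)=\{f[X]:f:\mathbb X\hookrightarrow\mathbb X\}$, regarded as a poset ordered by $\subset$. For a partial order $\mathbb P=\langle P,\le\rangle$ let $p\le^* q$ iff $\forall r\le p\,\exists s\le r\; s\le q$, and $p=^*q$ iff $p\le^*q$ and $q\le^*p$. The separative quotient $\operatorname{sq}\mathbb P$ is the separative partial order $P/{=^*}$ with $[p]\trianglelefteq[q]\Leftrightarrow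 p\le^*q$. For a separative partial order $\mathbb Q$, $\operatorname{ro}\mathbb Q$ is its Boolean completion (the complete Boolean algebra, unique up to isomorphism, in whose set of non-zero elements $\mathbb Q$ is isomorphic to a dense suborder). -}

module Defs where

open import Axiom.ExcludedMiddle using (ExcludedMiddle)
open import Data.Bool.Base using (Bool; true; false)
open import Data.Nat.Base using (ℕ)
import Data.Nat.Base as ℕ
open import Data.Product.Base using (∃; ∃-syntax; _×_; _,_; proj₁; proj₂; swap)
open import Data.Sum.Base using (_⊎_; inj₁; inj₂)
open import Data.Vec.Base using (Vec; map)
open import Function.Bundles using (_⇔_)
open import Function.Definitions using (Injective; Surjective; StrictlySurjective)
open import Level using (Level; suc)
open import Relation.Binary.Bundles using (Poset)
open import Relation.Binary.Lattice.Bundles using (BooleanAlgebra)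
open import Relation.Binary.Morphism.Structures
  using (IsOrderMonomorphism; IsOrderIsomorphism)
open import Relation.Binary.PropositionalEquality using (_≡_; refl)
open import Relation.Nullary using (¬_; yes; no; does; contradiction)
open import Relation.Nullary.Decidable using (dec-true)
open import Relation.Unary using (Pred; _⊆_; _≐_)

-- A single universe Set ℓ plays the role of the universe of sets throughout.

infix 4 _↪_ _≅_ _⇄_ _≅ᴾ_ _≅ᴮ_

------------------------------------------------------------------------
-- Relational structures and their embeddings

record Language (ℓ : Level) : Set (suc ℓ) where
  field
    Symbol  : Set ℓ
    arity   : Symbol → ℕ
    1≤arity : ∀ i → 1 ℕ.≤ arity i

record Structure {ℓ} (L : Language ℓ) : Set (suc ℓ) where
  open Language L
  field
    Carrier  : Set ℓ
    nonempty : Carrier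
    rel      : (i : Symbol) → Pred (Vec Carrier (arity i)) ℓ

record _↪_ {ℓ} {L : Language ℓ} (X Y : Structure L) : Set ℓ where
  open Language L
  private
    module X = Structure X
    module Y = Structure Y
  field
    to        : X.Carrier → Y.Carrier
    injective : Injective _≡_ _≡_ to
    rel-⇔     : ∀ i (xs : Vec X.Carrier (arity i)) →
                X.rel i xs ⇔ Y.rel i (map to xs)

_≅_ : ∀ {ℓ} {L : Language ℓ} → Structure L → Structure L → Set ℓ
X ≅ Y = ∃ λ (f : X ↪ Y) → StrictlySurjective _≡_ (_↪_.to f)

_⇄_ : ∀ {ℓ} {L : Language ℓ} → Structure L → Structure L → Set ℓ
X ⇄ Y = (X ↪ Y) × (Y ↪ X)

------------------------------------------------------------------------
-- The poset of copies of a structure inside itself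

image : ∀ {ℓ} {A B : Set ℓ} → (A → B) → Pred B ℓ
image f y = ∃ λ x → f x ≡ y

-- The copy f[X] is represented by f; representatives with the same image are
-- identified by the equality of the poset, which is extensional equality of
-- the images.
ℙ : ∀ {ℓ} {L : Language ℓ} → Structure L → Poset ℓ ℓ ℓ
ℙ X = record
  { Carrier        = X ↪ X
  ; _≈_            = λ f g → copy f ≐ copy g
  ; _≤_            = λ f g → copy f ⊆ copy g
  ; isPartialOrder = record
    { isPreorder = record
      { isEquivalence = record
        { refl  = (λ p → p) , (λ p → p)
        ; sym   = swap
        ; trans = λ (a , b) (c , d) → (λ p → c (a p)) , (λ p → b (d p))
        }
      ; reflexive = proj₁
      ; trans     = λ a b p → b (a p)
      }
    ; antisym = λ a b → a , b
    }
  }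
  where
  copy : (f : X ↪ X) → Pred (Structure.Carrier X) _
  copy f = image (_↪_.to f)

------------------------------------------------------------------------
-- Isomorphism of posets, separative quotient

_≅ᴾ_ : ∀ {ℓ} → Poset ℓ ℓ ℓ → Poset ℓ ℓ ℓ → Set ℓ
P ≅ᴾ Q = ∃ (IsOrderIsomorphism P._≈_ Q._≈_ P._≤_ Q._≤_)
  where
  module P = Poset P
  module Q = Poset Q

module _ {ℓ} (P : Poset ℓ ℓ ℓ) where
  open Poset P

  _≤*_ : Carrier → Carrier → Set ℓ
  p ≤* q = ∀ r → r ≤ p → ∃[ s ] s ≤ r × s ≤ q

  _=*_ : Carrier → Carrier → Set ℓ
  p =* q = (p ≤* q) × (q ≤* p)

-- The quotient P / =* is the setoid with the carrier of P and equality =*.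
sq : ∀ {ℓ} → Poset ℓ ℓ ℓ → Poset ℓ ℓ ℓ
sq P = record
  { Carrier        = P.Carrier
  ; _≈_            = _=*_ P
  ; _≤_            = _≤*_ P
  ; isPartialOrder = record
    { isPreorder = record
      { isEquivalence = record
        { refl  = ≤*-refl , ≤*-refl
        ; sym   = swap
        ; trans = λ (a , b) (c , d) → ≤*-trans a c , ≤*-trans d b
        }
      ; reflexive = proj₁
      ; trans     = ≤*-trans
      }
    ; antisym = λ a b → a , b
    }
  }
  where
  module P = Poset P

  ≤*-refl : ∀ {p} → _≤*_ P p p
  ≤*-refl r r≤p = r , P.refl , r≤p

  ≤*-trans : ∀ {p q t} → _≤*_ P p q → _≤*_ P q t → _≤*_ P p t
  ≤*-trans a b r r≤p =
    let s , s≤r , s≤q = a r r≤p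
        u , u≤s , u≤t = b s s≤q
    in u , P.trans u≤s s≤r , u≤t

------------------------------------------------------------------------
-- Complete Boolean algebras and Boolean completions

IsBooleanIsomorphism : ∀ {ℓ} (A B : BooleanAlgebra ℓ ℓ ℓ) →
  (BooleanAlgebra.Carrier A → BooleanAlgebra.Carrier B) → Set ℓ
IsBooleanIsomorphism A B h =
    (∀ {x y} → x A.≈ y → h x B.≈ h y)
  × (∀ x y → h (x A.∨ y) B.≈ (h x B.∨ h y))
  × (∀ x y → h (x A.∧ y) B.≈ (h x B.∧ h y))
  × (∀ x → h (A.¬ x) B.≈ (B.¬ h x))
  × (h A.⊤ B.≈ B.⊤)
  × (h A.⊥ B.≈ B.⊥)
  × Injective A._≈_ B._≈_ h
  × Surjective A._≈_ B._≈_ h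
  where
  module A = BooleanAlgebra A
  module B = BooleanAlgebra B

_≅ᴮ_ : ∀ {ℓ} → BooleanAlgebra ℓ ℓ ℓ → BooleanAlgebra ℓ ℓ ℓ → Set ℓ
A ≅ᴮ B = ∃ (IsBooleanIsomorphism A B)

-- Suprema suffice: infima are complements of suprema of complements.
record IsComplete {ℓ} (B : BooleanAlgebra ℓ ℓ ℓ) : Set (suc ℓ) where
  open BooleanAlgebra B using (Carrier; _≤_)
  field
    ⋁       : Pred Carrier ℓ → Carrier
    ⋁-upper : ∀ S {x} → S x → x ≤ ⋁ S
    ⋁-least : ∀ S u → (∀ {x} → S x → x ≤ u) → ⋁ S ≤ u

-- For separative Q any two completions are isomorphic, classically, so "ro Q"
-- is read as an arbitrary one.
record BooleanCompletion {ℓ} (Q : Poset ℓ ℓ ℓ) : Set (suc ℓ) where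
  field
    algebra    : BooleanAlgebra ℓ ℓ ℓ
    isComplete : IsComplete algebra

  private
    module Q = Poset Q
    module B = BooleanAlgebra algebra

  field
    embed               : Q.Carrier → B.Carrier
    isOrderMonomorphism : IsOrderMonomorphism Q._≈_ B._≈_ Q._≤_ B._≤_ embed
    nonzero             : ∀ q → ¬ (embed q B.≈ B.⊥)
    dense               : ∀ b → ¬ (b B.≈ B.⊥) → ∃[ q ] embed q B.≤ b

------------------------------------------------------------------------
-- Classically, every separative quotient has a Boolean completion.  Excluded
-- middle is what makes the power set, here Carrier → Bool, a set of Set ℓ
-- closed under all comprehensions.  Subsets are compared through the regular
-- open sets they generate, so every subset of P represents an element.

module _ {ℓ} (em : ExcludedMiddle ℓ) (P : Poset ℓ ℓ ℓ) where
  open Poset P using (Carrier; _≤_) renaming (refl to ≤-refl; trans to ≤-trans)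

  private
    Subset : Set ℓ
    Subset = Carrier → Bool

    _∈_ : Carrier → Subset → Set
    p ∈ S = S p ≡ true

    ⟦_⟧ : Pred Carrier ℓ → Subset
    ⟦ φ ⟧ p = does (em {φ p})

    ∈⁺ : ∀ (φ : Pred Carrier ℓ) {p} → φ p → p ∈ ⟦ φ ⟧
    ∈⁺ φ {p} = dec-true (em {φ p})

    ∈⁻ : ∀ (φ : Pred Carrier ℓ) {p} → p ∈ ⟦ φ ⟧ → φ p
    ∈⁻ φ {p} eq with em {φ p}
    ∈⁻ φ {p} eq | yes x = x
    ∈⁻ φ {p} () | no _

    Below : Subset → Pred Carrier ℓ
    Below S s = ∃[ t ] (t ∈ S × s ≤ t)

    _≼_ : Subset → Subset → Set ℓ
    S ≼ T = ∀ p → p ∈ S → ∀ r → r ≤ p → ∃[ s ] s ≤ r × Below T s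

    _≋_ : Subset → Subset → Set ℓ
    S ≋ T = (S ≼ T) × (T ≼ S)

    ≼-refl : ∀ {S} → S ≼ S
    ≼-refl p p∈S r r≤p = r , ≤-refl , p , p∈S , r≤p

    ≼-trans : ∀ {S T U} → S ≼ T → T ≼ U → S ≼ U
    ≼-trans a b p p∈S r r≤p =
      let s , s≤r , t , t∈T , s≤t = a p p∈S r r≤p
          s′ , s′≤s , below       = b t t∈T s s≤t
      in s′ , ≤-trans s′≤s s≤r , below

    ⊆⇒≼ : ∀ {S T} → (∀ p → p ∈ S → p ∈ T) → S ≼ T
    ⊆⇒≼ S⊆T p p∈S r r≤p = r , ≤-refl , p , S⊆T p p∈S , r≤p

    Join Meet : Subset → Subset → Pred Carrier ℓ
    Join S T p = Below S p ⊎ Below T p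
    Meet S T p = Below S p × Below T p

    Comp : Subset → Pred Carrier ℓ
    Comp S p = ∀ s → s ≤ p → ¬ Below S s

    Union : Pred Subset ℓ → Pred Carrier ℓ
    Union 𝒮 p = ∃[ S ] (𝒮 S × p ∈ S)

    below : ∀ {S p} → p ∈ S → Below S p
    below p∈S = _ , p∈S , ≤-refl

    below-down : ∀ {S p r} → r ≤ p → Below S p → Below S r
    below-down r≤p (t , t∈S , p≤t) = t , t∈S , ≤-trans r≤p p≤t

    full empty : Subset
    full  _ = true
    empty _ = false

    join-least : ∀ S T U → S ≼ U → T ≼ U → ⟦ Join S T ⟧ ≼ U
    join-least S T U a b p p∈ r r≤p with ∈⁻ (Join S T) p∈
    ... | inj₁ (t , t∈S , p≤t) = a t t∈S r (≤-trans r≤p p≤t)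
    ... | inj₂ (t , t∈T , p≤t) = b t t∈T r (≤-trans r≤p p≤t)

    meet-greatest : ∀ S T U → U ≼ S → U ≼ T → U ≼ ⟦ Meet S T ⟧
    meet-greatest S T U a b p p∈U r r≤p =
      let s , s≤r , s∈S   = a p p∈U r r≤p
          t , t≤s , t∈T   = b p p∈U s (≤-trans s≤r r≤p)
      in t , ≤-trans t≤s s≤r , below (∈⁺ (Meet S T) (below-down t≤s s∈S , t∈T))

    imp⁺ : ∀ W S T → ⟦ Meet W S ⟧ ≼ T → W ≼ ⟦ Join ⟦ Comp S ⟧ T ⟧
    imp⁺ W S T a p p∈W r r≤p with em {∃[ s ] s ≤ r × Below S s}
    ... | yes (s , s≤r , s∈S) =
      let s∈W              = p , p∈W , ≤-trans s≤r r≤p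
          s′ , s′≤s , s′∈T = a s (∈⁺ (Meet W S) (s∈W , s∈S)) s ≤-refl
      in s′ , ≤-trans s′≤s s≤r , below (∈⁺ (Join ⟦ Comp S ⟧ T) (inj₂ s′∈T))
    ... | no ∄s =
      r , ≤-refl , below (∈⁺ (Join ⟦ Comp S ⟧ T)
        (inj₁ (below (∈⁺ (Comp S) λ s s≤r s∈S → ∄s (s , s≤r , s∈S)))))

    imp⁻ : ∀ W S T → W ≼ ⟦ Join ⟦ Comp S ⟧ T ⟧ → ⟦ Meet W S ⟧ ≼ T
    imp⁻ W S T a p p∈ r r≤p with ∈⁻ (Meet W S) p∈
    ... | (w , w∈W , p≤w) , p∈S with a w w∈W r (≤-trans r≤p p≤w)
    ... | s , s≤r , t , t∈ , s≤t with ∈⁻ (Join ⟦ Comp S ⟧ T) t∈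
    ... | inj₁ (c , c∈ , t≤c) =
      contradiction (below-down (≤-trans s≤r r≤p) p∈S)
                    (∈⁻ (Comp S) c∈ s (≤-trans s≤t t≤c))
    ... | inj₂ t∈T = s , s≤r , below-down s≤t t∈T

    regularOpen : BooleanAlgebra ℓ ℓ ℓ
    regularOpen = record
      { Carrier = Subset
      ; _≈_ = _≋_
      ; _≤_ = _≼_
      ; _∨_ = λ S T → ⟦ Join S T ⟧
      ; _∧_ = λ S T → ⟦ Meet S T ⟧
      ; ¬_  = λ S → ⟦ Comp S ⟧
      ; ⊤   = full
      ; ⊥   = empty
      ; isBooleanAlgebra = record
        { isHeytingAlgebra = record
          { isBoundedLattice = record
            { isLattice = record
              { isPartialOrder = record
                { isPreorder = record
                  { isEquivalence = record
                    { refl  = ≼-refl , ≼-refl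
                    ; sym   = swap
                    ; trans = λ (a , b) (c , d) → ≼-trans a c , ≼-trans d b
                    }
                  ; reflexive = proj₁
                  ; trans     = ≼-trans
                  }
                ; antisym = λ a b → a , b
                }
              ; supremum = λ S T →
                  ⊆⇒≼ (λ p p∈S → ∈⁺ (Join S T) (inj₁ (below p∈S)))
                , ⊆⇒≼ (λ p p∈T → ∈⁺ (Join S T) (inj₂ (below p∈T)))
                , join-least S T
              ; infimum = λ S T →
                  (λ p p∈ r r≤p → r , ≤-refl ,
                     below-down r≤p (proj₁ (∈⁻ (Meet S T) p∈)))
                , (λ p p∈ r r≤p → r , ≤-refl ,
                     below-down r≤p (proj₂ (∈⁻ (Meet S T) p∈)))
                , meet-greatest S T
              }
            ; maximum = λ S → ⊆⇒≼ λ _ _ → refl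
            ; minimum = λ S p ()
            }
          ; exponential = λ W S T → imp⁺ W S T , imp⁻ W S T
          }
        }
      }

    principal : Carrier → Subset
    principal q = ⟦ _≤ q ⟧

    principal-mono : ∀ {p q} → _≤*_ P p q → principal p ≼ principal q
    principal-mono {p} {q} p≤*q x x∈ r r≤x =
      let s , s≤r , s≤q = p≤*q r (≤-trans r≤x (∈⁻ (_≤ p) x∈))
      in s , s≤r , below (∈⁺ (_≤ q) s≤q)

    principal-cancel : ∀ {p q} → principal p ≼ principal q → _≤*_ P p q
    principal-cancel {p} {q} a r r≤p =
      let s , s≤r , t , t∈ , s≤t = a p (∈⁺ (_≤ p) ≤-refl) r r≤p
      in s , s≤r , ≤-trans s≤t (∈⁻ (_≤ q) t∈)

    principal-nonzero : ∀ q → ¬ (principal q ≋ empty)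
    principal-nonzero q (a , _) with a q (∈⁺ (_≤ q) ≤-refl) q ≤-refl
    ... | _ , _ , _ , () , _

    principal-dense : ∀ S → ¬ (S ≋ empty) → ∃[ q ] principal q ≼ S
    principal-dense S S≢∅ with em {∃[ q ] q ∈ S}
    ... | yes (q , q∈S) = q , λ x x∈ r r≤x →
      r , ≤-refl , q , q∈S , ≤-trans r≤x (∈⁻ (_≤ q) x∈)
    ... | no ∄q = contradiction ((λ p p∈S → contradiction (p , p∈S) ∄q) , λ p ()) S≢∅

  ro-sq : BooleanCompletion (sq P)
  ro-sq = record
    { algebra    = regularOpen
    ; isComplete = record
      { ⋁       = λ 𝒮 → ⟦ Union 𝒮 ⟧
      ; ⋁-upper = λ 𝒮 S∈𝒮 → ⊆⇒≼ λ p p∈S → ∈⁺ (Union 𝒮) (_ , S∈𝒮 , p∈S)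
      ; ⋁-least = λ 𝒮 U bound p p∈ →
          let _ , S∈𝒮 , p∈S = ∈⁻ (Union 𝒮) p∈ in bound S∈𝒮 p p∈S
      }
    ; embed               = principal
    ; isOrderMonomorphism = record
      { isOrderHomomorphism = record
        { cong = λ (a , b) → principal-mono a , principal-mono b
        ; mono = principal-mono
        }
      ; injective = λ (a , b) → principal-cancel a , principal-cancel b
      ; cancel    = principal-cancel
      }
    ; nonzero = principal-nonzero
    ; dense   = principal-dense
    }

{-# OPTIONS --safe #-}

-- Part (b).  An embedding f : X ↪ Y places the copies f[p[X]] of X and the
-- copies q[Y] of Y in one poset of subsets of Y.  Using g : Y ↪ X, each copy of
-- X contains one of Y, and each copy of Y inside a copy of X contains a copy of
-- X.  Hence the completion of P(X) is isomorphic to the ideal of the completion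
-- of P(Y) generated by the join of the copies of Y inside f[X].  Exchanging X
-- and Y, each completion is isomorphic to a principal ideal of the other, and
-- the Cantor–Bernstein theorem for complete Boolean algebras applies.

module Submission where

open import Defs
open import Axiom.ExcludedMiddle using (ExcludedMiddle)
open import Data.Product.Base using (∃; ∃-syntax; _×_; _,_; proj₁; proj₂)
open import Data.Vec.Base using (map)
open import Data.Vec.Properties using (map-cong; map-∘; map-id)
open import Function.Base using (_∘_; id)
open import Function.Bundles using (_⇔_)
open import Function.Construct.Composition using (_⇔-∘_)
open import Function.Construct.Identity using (⇔-id)
open import Function.Construct.Symmetry using (⇔-sym)
open import Function.Definitions using (Injective; StrictlySurjective)
open import Level using (Level)
open import Relation.Binary.Bundles using (Poset)
open import Relation.Binary.Core using (Rel)
open import Relation.Binary.Definitions using (Transitive)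
open import Relation.Binary.Lattice.Bundles using (BooleanAlgebra)
import Relation.Binary.Lattice.Properties.HeytingAlgebra as HeytingProperties
import Relation.Binary.Lattice.Properties.MeetSemilattice as MeetProperties
open import Relation.Binary.Morphism.Structures using (IsOrderMonomorphism)
open import Relation.Binary.PropositionalEquality
  using (_≡_; refl; sym; trans; cong; subst)
open import Relation.Nullary using (¬_; yes; no; contradiction)
open import Relation.Unary using (Pred; _⊆_)

private
  variable
    ℓ : Level

-- Boolean algebras

module BooleanProperties (A : BooleanAlgebra ℓ ℓ ℓ) where
  open BooleanAlgebra A renaming (¬_ to ∁_; trans to ≤-trans; refl to ≤-refl)
  open HeytingProperties heytingAlgebra using (∧-distribˡ-∨-≤)

  -- The implication from `y` to `⊥` unfolds to `∁ y ∨ ⊥`, so transposing the meet gives the bound.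
  disjoint⇒≤∁ : ∀ {x y} → x ∧ y ≤ ⊥ → x ≤ ∁ y
  disjoint⇒≤∁ x∧y≤⊥ =
    ≤-trans (transpose-⇨ x∧y≤⊥) (∨-least ≤-refl (minimum _))

  ≤∁⇒disjoint : ∀ {x y} → x ≤ ∁ y → x ∧ y ≤ ⊥
  ≤∁⇒disjoint x≤∁y = transpose-∧ (≤-trans x≤∁y (x≤x∨y _ _))

  ∁-swap : ∀ {x y} → x ≤ ∁ y → y ≤ ∁ x
  ∁-swap x≤∁y = disjoint⇒≤∁
    (≤-trans (∧-greatest (x∧y≤y _ _) (x∧y≤x _ _)) (≤∁⇒disjoint x≤∁y))

  ∁-antitone : ∀ {x y} → x ≤ y → ∁ y ≤ ∁ x
  ∁-antitone x≤y = ∁-swap (≤-trans x≤y (∁-swap ≤-refl))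

  -- Transposing the first hypothesis gives `x ≤ ∁ z ∨ y`; then `x` is distributed over this join.
  ≤-by-cases : ∀ z {x y} → x ∧ z ≤ y → x ∧ ∁ z ≤ y → x ≤ y
  ≤-by-cases z {x} {y} x∧z≤y x∧∁z≤y =
    ≤-trans (∧-greatest ≤-refl (transpose-⇨ x∧z≤y))
    (≤-trans (∧-distribˡ-∨-≤ x (∁ z) y) (∨-least x∧∁z≤y (x∧y≤y x y)))

  ∁∁-≤ : ∀ {x} → ∁ ∁ x ≤ x
  ∁∁-≤ {x} = ≤-by-cases x (x∧y≤y _ _)
    (≤-trans (≤∁⇒disjoint ≤-refl) (minimum _))

  cover⇒∁≤ : ∀ {x y} → ⊤ ≤ x ∨ y → ∁ x ≤ y
  cover⇒∁≤ {x} {y} ⊤≤x∨y = ≤-trans (∧-greatest (≤-trans (maximum _) ⊤≤x∨y) ≤-refl)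
    (transpose-∧ (∨-least (≤-trans (∁-swap ≤-refl) (x≤x∨y _ _)) (y≤x∨y _ _)))

  ⊤≤x∨∁x : ∀ {x} → ⊤ ≤ x ∨ ∁ x
  ⊤≤x∨∁x {x} = ≤-by-cases x (≤-trans (x∧y≤y _ _) (x≤x∨y _ _))
                            (≤-trans (x∧y≤y _ _) (y≤x∨y _ _))

  [u∨v]∧x≤u : ∀ {u v x} → v ≤ ∁ x → (u ∨ v) ∧ x ≤ u
  [u∨v]∧x≤u v≤∁x =
    transpose-∧ (∨-least (y≤x∨y _ _) (≤-trans v≤∁x (x≤x∨y _ _)))

  [u∨v]∧∁x≤v : ∀ {u v x} → u ≤ x → (u ∨ v) ∧ ∁ x ≤ v
  [u∨v]∧∁x≤v u≤x = transpose-∧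
    (∨-least (≤-trans u≤x (≤-trans (∁-swap ≤-refl) (x≤x∨y _ _))) (y≤x∨y _ _))

-- Isomorphisms and ideal embeddings of Boolean algebras

module _ (A B : BooleanAlgebra ℓ ℓ ℓ) where
  private
    module A where
      open BooleanAlgebra A public
      open BooleanProperties A public
    module B where
      open BooleanAlgebra B public
      open BooleanProperties B public

  -- The order determines meets, joins and bounds, and these determine the complement as the element
  -- that is disjoint from `x` and covers `⊤` with it.
  orderIsomorphism⇒≅ᴮ : (h : A.Carrier → B.Carrier) →
    (∀ {x y} → x A.≤ y → h x B.≤ h y) →
    (∀ {x y} → h x B.≤ h y → x A.≤ y) →
    StrictlySurjective B._≈_ h → A ≅ᴮ B
  orderIsomorphism⇒≅ᴮ h mono cancel onto =
    h , h-cong , h-∨ , h-∧ , h-∁ , h-⊤ , h-⊥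
      , (λ eq → A.antisym (cancel (B.reflexive eq))
                          (cancel (B.reflexive (B.Eq.sym eq))))
      , λ y → let x , hx≈y = onto y in x , λ z≈x → B.Eq.trans (h-cong z≈x) hx≈y
    where
    h-cong : ∀ {x y} → x A.≈ y → h x B.≈ h y
    h-cong eq = B.antisym (mono (A.reflexive eq)) (mono (A.reflexive (A.Eq.sym eq)))

    ≤h : ∀ {x y} → (∀ z → h z B.≤ y → z A.≤ x) → y B.≤ h x
    ≤h {x} {y} below =
      let z , hz≈y = onto y
      in B.trans (B.reflexive (B.Eq.sym hz≈y))
                 (mono (below z (B.reflexive hz≈y)))

    h≤ : ∀ {x y} → (∀ z → y B.≤ h z → x A.≤ z) → h x B.≤ y
    h≤ {x} {y} above =
      let z , hz≈y = onto y
      in B.trans (mono (above z (B.reflexive (B.Eq.sym hz≈y)))) (B.reflexive hz≈y)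

    h-∨ : ∀ x y → h (x A.∨ y) B.≈ (h x B.∨ h y)
    h-∨ x y = B.antisym
      (h≤ λ z le → A.∨-least (cancel (B.trans (B.x≤x∨y _ _) le))
                             (cancel (B.trans (B.y≤x∨y _ _) le)))
      (B.∨-least (mono (A.x≤x∨y _ _)) (mono (A.y≤x∨y _ _)))

    h-∧ : ∀ x y → h (x A.∧ y) B.≈ (h x B.∧ h y)
    h-∧ x y = B.antisym
      (B.∧-greatest (mono (A.x∧y≤x _ _)) (mono (A.x∧y≤y _ _)))
      (≤h λ z le → A.∧-greatest (cancel (B.trans le (B.x∧y≤x _ _)))
                                (cancel (B.trans le (B.x∧y≤y _ _))))

    h-⊤ : h A.⊤ B.≈ B.⊤
    h-⊤ = B.antisym (B.maximum _) (≤h λ z _ → A.maximum z)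

    h-⊥ : h A.⊥ B.≈ B.⊥
    h-⊥ = B.antisym (h≤ λ z _ → A.minimum z) (B.minimum _)

    h-∁ : ∀ x → h (A.¬ x) B.≈ (B.¬ h x)
    h-∁ x = B.antisym
      (B.disjoint⇒≤∁ (B.trans (B.reflexive (B.Eq.sym (h-∧ _ _)))
        (B.trans (mono (A.≤∁⇒disjoint A.refl)) (B.reflexive h-⊥))))
      (B.cover⇒∁≤ (B.trans (B.reflexive (B.Eq.sym h-⊤))
        (B.trans (mono A.⊤≤x∨∁x) (B.reflexive (h-∨ _ _)))))

  -- An isomorphism of `A` onto the principal ideal of `B` below `to A.⊤`, expressed through the
  -- order.
  record IdealEmbedding : Set ℓ where
    field
      to     : A.Carrier → B.Carrier
      mono   : ∀ {x y} → x A.≤ y → to x B.≤ to y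
      cancel : ∀ {x y} → to x B.≤ to y → x A.≤ y
      onto   : ∀ {y} → y B.≤ to A.⊤ → ∃[ x ] to x B.≈ y

-- Fixed points and the Cantor-Bernstein theorem

knaster-tarski : (A : BooleanAlgebra ℓ ℓ ℓ) → IsComplete A →
  let open BooleanAlgebra A in
  (F : Carrier → Carrier) → (∀ {x y} → x ≤ y → F x ≤ F y) → ∃[ x ] F x ≈ x
knaster-tarski A complete F F-mono = x , antisym Fx≤x x≤Fx
  where
  open BooleanAlgebra A renaming (trans to ≤-trans)
  open IsComplete complete
  -- The join of all post-fixed points is again post-fixed; so is its image under `F`, which
  -- therefore lies below it.
  x    = ⋁ (λ z → z ≤ F z)
  x≤Fx = ⋁-least _ _ λ z≤Fz → ≤-trans z≤Fz (F-mono (⋁-upper _ z≤Fz))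
  Fx≤x = ⋁-upper _ (F-mono x≤Fx)

-- With x such that h x and k (∁ h x) = ∁ x are complementary parts, glue h on
-- the part below x to the inverse of k on the part below ∁ x.
cantor-bernstein : {A B : BooleanAlgebra ℓ ℓ ℓ} → IsComplete A →
  IdealEmbedding A B → IdealEmbedding B A → A ≅ᴮ B
cantor-bernstein {A = A} {B} complete h k =
  orderIsomorphism⇒≅ᴮ A B φ φ-mono φ-cancel φ-onto
  where
  module A where
    open BooleanAlgebra A public
    open BooleanProperties A public
    open MeetProperties meetSemilattice public using (∧-monotonic)
  module B where
    open BooleanAlgebra B public
    open BooleanProperties B public
    open MeetProperties meetSemilattice public using (∧-monotonic)
  module h = IdealEmbedding h
  module k = IdealEmbedding k

  fixpoint : ∃[ x ] (A.¬ k.to (B.¬ h.to x)) A.≈ x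
  fixpoint = knaster-tarski A complete _
    λ x≤y → A.∁-antitone (k.mono (B.∁-antitone (h.mono x≤y)))

  x  = proj₁ fixpoint
  hx = h.to x

  ∁x≤k : (A.¬ x) A.≤ k.to (B.¬ hx)
  ∁x≤k = A.trans (A.∁-antitone (A.reflexive (proj₂ fixpoint))) A.∁∁-≤

  k≤∁x : k.to (B.¬ hx) A.≤ (A.¬ x)
  k≤∁x = A.∁-swap (A.reflexive (A.Eq.sym (proj₂ fixpoint)))

  k-preimage : ∀ z → ∃[ y ] k.to y A.≈ (z A.∧ A.¬ x)
  k-preimage z = k.onto
    (A.trans (A.x∧y≤y _ _) (A.trans ∁x≤k (k.mono (B.maximum _))))

  lo hi φ : A.Carrier → B.Carrier
  lo z = h.to (z A.∧ x)
  hi z = proj₁ (k-preimage z)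
  φ  z = lo z B.∨ hi z

  k-hi≤ : ∀ z → k.to (hi z) A.≤ (z A.∧ A.¬ x)
  k-hi≤ z = A.reflexive (proj₂ (k-preimage z))

  ≤k-hi : ∀ z → (z A.∧ A.¬ x) A.≤ k.to (hi z)
  ≤k-hi z = A.reflexive (A.Eq.sym (proj₂ (k-preimage z)))

  lo≤hx : ∀ z → lo z B.≤ hx
  lo≤hx z = h.mono (A.x∧y≤y _ _)

  hi≤∁hx : ∀ z → hi z B.≤ (B.¬ hx)
  hi≤∁hx z = k.cancel (A.trans (k-hi≤ z) (A.trans (A.x∧y≤y _ _) ∁x≤k))

  hi-mono : ∀ {z z′} → (z A.∧ A.¬ x) A.≤ (z′ A.∧ A.¬ x) → hi z B.≤ hi z′
  hi-mono le = k.cancel (A.trans (k-hi≤ _) (A.trans le (≤k-hi _)))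

  hi-cancel : ∀ {z z′} → hi z B.≤ hi z′ → (z A.∧ A.¬ x) A.≤ (z′ A.∧ A.¬ x)
  hi-cancel le = A.trans (≤k-hi _) (A.trans (k.mono le) (k-hi≤ _))

  φ-mono : ∀ {z z′} → z A.≤ z′ → φ z B.≤ φ z′
  φ-mono z≤z′ = B.∨-least
    (B.trans (h.mono (A.∧-monotonic z≤z′ A.refl)) (B.x≤x∨y _ _))
    (B.trans (hi-mono (A.∧-monotonic z≤z′ A.refl)) (B.y≤x∨y _ _))

  -- Meeting with `hx` and with its complement separates the two summands of `φ`, so `z` and `z′`
  -- can be compared on `x` and on `∁ x`.
  φ-cancel : ∀ {z z′} → φ z B.≤ φ z′ → z A.≤ z′
  φ-cancel {z} {z′} le = A.≤-by-cases x
    (A.trans (h.cancel lo≤lo) (A.x∧y≤x _ _))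
    (A.trans (hi-cancel hi≤hi) (A.x∧y≤x _ _))
    where
    lo≤lo : lo z B.≤ lo z′
    lo≤lo = B.trans (B.∧-greatest (B.trans (B.x≤x∨y _ _) le) (lo≤hx z))
                    (B.[u∨v]∧x≤u (hi≤∁hx z′))
    hi≤hi : hi z B.≤ hi z′
    hi≤hi = B.trans (B.∧-greatest (B.trans (B.y≤x∨y _ _) le) (hi≤∁hx z))
                    (B.[u∨v]∧∁x≤v (lo≤hx z′))

  φ-onto : StrictlySurjective B._≈_ φ
  -- The witness joins the `h`-preimage of the part of `w` below `hx` to the `k`-image of the rest.
  -- These pieces lie below `x` and `∁ x`, so cutting `z` at `x` returns them.
  φ-onto w = z , B.antisym (B.∨-least lo≤w hi≤w) (B.≤-by-cases hx ≤lo ≤hi)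
    where
    h-preimage : ∃[ u ] h.to u B.≈ (w B.∧ hx)
    h-preimage = h.onto (B.trans (B.x∧y≤y _ _) (h.mono (A.maximum _)))
    u = proj₁ h-preimage
    v = k.to (w B.∧ B.¬ hx)
    z = u A.∨ v

    hu≤ : h.to u B.≤ (w B.∧ hx)
    hu≤ = B.reflexive (proj₂ h-preimage)

    u≤x : u A.≤ x
    u≤x = h.cancel (B.trans hu≤ (B.x∧y≤y _ _))

    v≤∁x : v A.≤ (A.¬ x)
    v≤∁x = A.trans (k.mono (B.x∧y≤y _ _)) k≤∁x

    lo≤w : lo z B.≤ w
    lo≤w = B.trans (h.mono (A.[u∨v]∧x≤u v≤∁x)) (B.trans hu≤ (B.x∧y≤x _ _))

    hi≤w : hi z B.≤ w
    hi≤w = B.trans (k.cancel (A.trans (k-hi≤ z) (A.[u∨v]∧∁x≤v u≤x))) (B.x∧y≤x _ _)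

    ≤lo : (w B.∧ hx) B.≤ φ z
    ≤lo = B.trans (B.reflexive (B.Eq.sym (proj₂ h-preimage)))
      (B.trans (h.mono (A.∧-greatest (A.x≤x∨y _ _) u≤x)) (B.x≤x∨y _ _))

    ≤hi : (w B.∧ B.¬ hx) B.≤ φ z
    ≤hi = B.trans
      (k.cancel (A.trans (A.∧-greatest (A.y≤x∨y _ _) v≤∁x) (≤k-hi z)))
      (B.y≤x∨y _ _)

-- Forcing with a poset that is dense in a complete Boolean algebra

module Forcing (em : ExcludedMiddle ℓ) (P : Poset ℓ ℓ ℓ)
               (𝔹 : BooleanCompletion (sq P)) where
  open BooleanCompletion 𝔹 public using (algebra)
  open BooleanCompletion 𝔹
    using (isComplete; embed; isOrderMonomorphism; nonzero; dense)
  open IsComplete isComplete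
  private
    module P = Poset P
    module e = IsOrderMonomorphism isOrderMonomorphism
    module B where
      open BooleanAlgebra algebra public
      open BooleanProperties algebra public

  infix 4 _⊩_

  _⊩_ : P.Carrier → B.Carrier → Set ℓ
  p ⊩ b = embed p B.≤ b

  -- The algebra sees only `≤*`, which, evaluated at `p` itself, yields a common extension.
  ≤*-compatible : ∀ {p q} → embed p B.≤ embed q → ∃[ r ] r P.≤ p × r P.≤ q
  ≤*-compatible {p} ep≤eq = e.cancel ep≤eq p P.refl

  ⊩-mono : ∀ {p q b} → p P.≤ q → q ⊩ b → p ⊩ b
  ⊩-mono p≤q q⊩b = B.trans
    (e.mono λ r r≤p → r , P.refl , P.trans r≤p p≤q) q⊩b

  ⊩-disjoint : ∀ {p a b} → (a B.∧ b) B.≤ B.⊥ → p ⊩ a → ¬ (p ⊩ b)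
  ⊩-disjoint a∧b≤⊥ p⊩a p⊩b =
    nonzero _ (B.antisym (B.trans (B.∧-greatest p⊩a p⊩b) a∧b≤⊥) (B.minimum _))

  incompatible⇒disjoint : ∀ {a b} → ¬ (∃[ p ] p ⊩ a × p ⊩ b) → (a B.∧ b) B.≤ B.⊥
  incompatible⇒disjoint {a} {b} ∄p with em {(a B.∧ b) B.≈ B.⊥}
  ... | yes a∧b≈⊥ = B.reflexive a∧b≈⊥
  ... | no  a∧b≉⊥ =
    let p , p⊩ = dense _ a∧b≉⊥
    in contradiction (p , B.trans p⊩ (B.x∧y≤x _ _) , B.trans p⊩ (B.x∧y≤y _ _)) ∄p

  -- Otherwise some `p` forces both `a` and the complement of `b`, and an extension of `p` would
  -- force `b` and its complement.
  densely⇒≤ : ∀ {a b} → (∀ {p} → p ⊩ a → ∃[ q ] q P.≤ p × q ⊩ b) → a B.≤ b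
  densely⇒≤ {a} {b} f = B.trans (B.disjoint⇒≤∁ (incompatible⇒disjoint
    λ (p , p⊩a , p⊩∁b) → let q , q≤p , q⊩b = f p⊩a in
      ⊩-disjoint (B.≤∁⇒disjoint B.refl) (⊩-mono q≤p p⊩∁b) q⊩b)) B.∁∁-≤

  join : Pred P.Carrier ℓ → B.Carrier
  join U = ⋁ λ b → ∃[ p ] U p × b ≡ embed p

  ⊩-join⁺ : ∀ {U p} → U p → p ⊩ join U
  ⊩-join⁺ u = ⋁-upper _ (_ , u , refl)

  -- If no such extension exists, `embed p` is disjoint from every generator, hence from the join
  -- above it, and so would be zero.
  ⊩-join⁻ : ∀ {U p} → p ⊩ join U → ∃[ q ] q P.≤ p × (∃[ u ] U u × q P.≤ u)
  ⊩-join⁻ {U} {p} p⊩ with em {∃[ q ] q P.≤ p × (∃[ u ] U u × q P.≤ u)}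
  ... | yes found = found
  ... | no  ∄q    = contradiction B.refl
    (⊩-disjoint (B.≤∁⇒disjoint (B.trans p⊩ join≤∁)) B.refl)
    where
    join≤∁ : join U B.≤ (B.¬ embed p)
    join≤∁ = ⋁-least _ _ λ { (u , Uu , refl) → B.disjoint⇒≤∁ (incompatible⇒disjoint
      λ (r , r⊩u , r⊩p) →
        -- Each comparison in the algebra gives only compatibility, so `r` is refined twice, first
        -- into `p` and then into `u`.
        let s , s≤r , s≤p = ≤*-compatible r⊩p
            t , t≤s , t≤u = ≤*-compatible (⊩-mono s≤r r⊩u)
        in ∄q (t , P.trans t≤s s≤p , u , Uu , t≤u)) }

  join-mono : ∀ {U V} → (∀ {p} → U p → V p) → join U B.≤ join V
  join-mono U⊆V = ⋁-least _ _ λ { (p , Up , refl) → ⊩-join⁺ (U⊆V Up) }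

-- Completions of two posets interleaved in a common order

module _ (em : ExcludedMiddle ℓ) (P Q : Poset ℓ ℓ ℓ)
         (𝔹 : BooleanCompletion (sq P)) (ℂ : BooleanCompletion (sq Q))
         {z} {Z : Set z} (_⊑_ : Rel Z ℓ) (⊑-trans : Transitive _⊑_) where
  private
    module P = Poset P
    module Q = Poset Q
    module 𝔹 = Forcing em P 𝔹
    module ℂ = Forcing em Q ℂ
    module B = BooleanAlgebra 𝔹.algebra
    module C = BooleanAlgebra ℂ.algebra

  -- Below every `i p` the values of `i` and `j` alternate, so they generate the same completion
  -- there. A `q` below no `i p` need not have a value of `i` below it, so the image is only the
  -- ideal below `to B.⊤`.
  common-extension⇒idealEmbedding :
    (i : P.Carrier → Z) (j : Q.Carrier → Z) →
    (∀ {p p′} → p P.≤ p′ → i p ⊑ i p′) → (∀ {p p′} → i p ⊑ i p′ → p P.≤ p′) →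
    (∀ {q q′} → q Q.≤ q′ → j q ⊑ j q′) → (∀ {q q′} → j q ⊑ j q′ → q Q.≤ q′) →
    (∀ p → ∃[ q ] j q ⊑ i p) → (∀ {p q} → j q ⊑ i p → ∃[ p′ ] i p′ ⊑ j q) →
    IdealEmbedding 𝔹.algebra ℂ.algebra
  common-extension⇒idealEmbedding
    i j i-mono i-cancel j-mono j-cancel shrink-i shrink-j = record
    { to     = to
    ; mono   = λ b≤b′ → ℂ.join-mono
        λ (p , p⊩b , q⊑p) → p , B.trans p⊩b b≤b′ , q⊑p
    ; cancel = λ le → 𝔹.densely⇒≤ (to-cancel le)
    ; onto   = λ {c} c≤ → from c , C.antisym
        (ℂ.densely⇒≤ to-from≤) (ℂ.densely⇒≤ (≤to-from c≤))
    }
    where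
    to : B.Carrier → C.Carrier
    to b = ℂ.join λ q → ∃[ p ] p 𝔹.⊩ b × j q ⊑ i p

    from : C.Carrier → B.Carrier
    from c = 𝔹.join λ p → ∃[ q ] q ℂ.⊩ c × i p ⊑ j q

    -- Refine `q` below a generator of `to b`, then shrink back into `P`; the result extends the `p`
    -- that witnesses the generator.
    to⁻ : ∀ {q b} → q ℂ.⊩ to b →
      ∃[ q′ ] ∃[ p ] q′ Q.≤ q × i p ⊑ j q′ × p 𝔹.⊩ b
    to⁻ q⊩ =
      let q′ , q′≤q , _ , (p , p⊩b , u⊑p) , q′≤u = ℂ.⊩-join⁻ q⊩
          q′⊑p     = ⊑-trans (j-mono q′≤u) u⊑p
          p′ , p′⊑ = shrink-j q′⊑p
      in q′ , p′ , q′≤q , p′⊑ , 𝔹.⊩-mono (i-cancel (⊑-trans p′⊑ q′⊑p)) p⊩b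

    to-cancel : ∀ {b b′} → to b C.≤ to b′ →
      ∀ {p} → p 𝔹.⊩ b → ∃[ p′ ] p′ P.≤ p × p′ 𝔹.⊩ b′
    to-cancel le {p} p⊩b =
      let q , q⊑p = shrink-i p
          q′ , p′ , q′≤q , p′⊑q′ , p′⊩b′ =
            to⁻ (C.trans (ℂ.⊩-join⁺ (p , p⊩b , q⊑p)) le)
      in p′ , i-cancel (⊑-trans p′⊑q′ (⊑-trans (j-mono q′≤q) q⊑p)) , p′⊩b′

    to-from≤ : ∀ {c q} → q ℂ.⊩ to (from c) → ∃[ q′ ] q′ Q.≤ q × q′ ℂ.⊩ c
    to-from≤ q⊩ =
      let q₁ , p , q₁≤q , p⊑q₁ , p⊩ = to⁻ q⊩
          -- Decoding `from c` gives a `p′` below both `q₁` and some `q₂` forcing `c`; any `q₃`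
          -- below `p′` extends both.
          p′ , p′≤p , u , (q₂ , q₂⊩c , u⊑q₂) , p′≤u = 𝔹.⊩-join⁻ p⊩
          q₃ , q₃⊑p′ = shrink-i p′
      in q₃ , Q.trans (j-cancel (⊑-trans q₃⊑p′ (⊑-trans (i-mono p′≤p) p⊑q₁))) q₁≤q
            , ℂ.⊩-mono (j-cancel (⊑-trans q₃⊑p′ (⊑-trans (i-mono p′≤u) u⊑q₂))) q₂⊩c

    ≤to-from : ∀ {c} → c C.≤ to B.⊤ →
      ∀ {q} → q ℂ.⊩ c → ∃[ q′ ] q′ Q.≤ q × q′ ℂ.⊩ to (from c)
    ≤to-from c≤ q⊩c =
      -- Membership in the ideal is what supplies an element of `P` below `q`.
      let q₁ , p , q₁≤q , p⊑q₁ , _ = to⁻ (C.trans q⊩c c≤)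
          q₂ , q₂⊑p = shrink-i p
      in q₂ , Q.trans (j-cancel (⊑-trans q₂⊑p p⊑q₁)) q₁≤q
            , ℂ.⊩-join⁺ (p , 𝔹.⊩-join⁺ (q₁ , ℂ.⊩-mono q₁≤q q⊩c , p⊑q₁) , q₂⊑p)

-- Embeddings of structures

module _ {L : Language ℓ} where
  open Language L

  infixr 9 _∘↪_

  _∘↪_ : {X Y Z : Structure L} → Y ↪ Z → X ↪ Y → X ↪ Z
  _∘↪_ {Z = Z} g f = record
    { to        = g.to ∘ f.to
    ; injective = f.injective ∘ g.injective
    ; rel-⇔     = λ i xs →
        subst (λ ys → _ ⇔ Structure.rel Z i ys) (sym (map-∘ g.to f.to xs))
              (g.rel-⇔ i (map f.to xs) ⇔-∘ f.rel-⇔ i xs)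
    }
    where
    module f = _↪_ f
    module g = _↪_ g

  id↪ : {X : Structure L} → X ↪ X
  id↪ {X} = record
    { to        = id
    ; injective = id
    ; rel-⇔     = λ i xs →
        subst (λ ys → _ ⇔ Structure.rel X i ys) (sym (map-id xs)) (⇔-id _)
    }

  -- The inclusion itself chooses a `g`-preimage of each `f x`. The relations pass to `h` because
  -- `g` reflects them.
  factor : {X Y Z : Structure L} (f : X ↪ Z) (g : Y ↪ Z) →
    image (_↪_.to f) ⊆ image (_↪_.to g) →
    ∃ λ (h : X ↪ Y) → ∀ x → _↪_.to g (_↪_.to h x) ≡ _↪_.to f x
  factor {X} {Y} {Z} f g f⊆g = record
    { to        = h
    ; injective = λ {x} {y} eq →
        f.injective (trans (sym (gh≡f x)) (trans (cong g.to eq) (gh≡f y)))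
    ; rel-⇔     = λ i xs →
        ⇔-sym (g.rel-⇔ i (map h xs)) ⇔-∘
        subst (λ zs → _ ⇔ Structure.rel Z i zs)
              (trans (sym (map-cong gh≡f xs)) (map-∘ g.to h xs)) (f.rel-⇔ i xs)
    } , gh≡f
    where
    module f = _↪_ f
    module g = _↪_ g
    h : Structure.Carrier X → Structure.Carrier Y
    h x = proj₁ (f⊆g (x , refl))
    gh≡f : ∀ x → g.to (h x) ≡ f.to x
    gh≡f x = proj₂ (f⊆g (x , refl))

image-∘-mono : ∀ {A A′ B C : Set ℓ} (f : B → C) {p : A → B} {p′ : A′ → B} →
  image p ⊆ image p′ → image (f ∘ p) ⊆ image (f ∘ p′)
image-∘-mono f p⊆p′ (x , refl) =
  let x′ , eq = p⊆p′ (x , refl) in x′ , cong f eq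

image-∘-cancel : ∀ {A A′ B C : Set ℓ} {f : B → C} {p : A → B} {p′ : A′ → B} →
  Injective _≡_ _≡_ f → image (f ∘ p) ⊆ image (f ∘ p′) → image p ⊆ image p′
image-∘-cancel inj fp⊆fp′ (x , refl) =
  let x′ , eq = fp⊆fp′ (x , refl) in x′ , inj eq

-- Isomorphic and equimorphic structures

module _ {L : Language ℓ} {X Y : Structure L} where

  -- Conjugation by `f` sends the copy `p[X]` to `f[p[X]]`, and conjugation by the inverse undoes
  -- this.
  ≅⇒ℙ≅ℙ : X ≅ Y → ℙ X ≅ᴾ ℙ Y
  ≅⇒ℙ≅ℙ (f , f-onto) = conj , record
    { isOrderMonomorphism = record
      { isOrderHomomorphism = record
        { cong = λ {p} {p′} (a , b) →
            conj-mono {p} {p′} a , conj-mono {p′} {p} b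
        ; mono = λ {p} {p′} → conj-mono {p} {p′}
        }
      ; injective = λ {p} {p′} (a , b) →
          conj-cancel {p} {p′} a , conj-cancel {p′} {p} b
      ; cancel = λ {p} {p′} → conj-cancel {p} {p′}
      }
    -- Surjectivity of setoid maps quantifies over every `p` with the same copy as the chosen
    -- preimage.
    ; surjective = λ q → f⁻¹ ∘↪ q ∘↪ f , λ {p} (a , b) →
          (λ { (y , refl) →
              let y′ , eq = a (_ , refl)
              in _ , trans (sym (ff⁻¹ _)) (cong f.to eq) })
        , λ { (y , refl) →
              let x , eq = b (f⁻¹.to y , refl)
              in f.to x , trans (cong (f.to ∘ _↪_.to p) (f⁻¹f x))
                    (trans (cong f.to eq) (trans (ff⁻¹ _) (cong (_↪_.to q) (ff⁻¹ y)))) }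
    }
    where
    module f = _↪_ f

    -- Surjectivity of `f` puts the image of `id↪` inside that of `f`.
    inverse : ∃ λ (g : Y ↪ X) → ∀ y → f.to (_↪_.to g y) ≡ y
    inverse = factor id↪ f λ {y} _ → f-onto y

    f⁻¹ : Y ↪ X
    f⁻¹ = proj₁ inverse
    module f⁻¹ = _↪_ f⁻¹

    ff⁻¹ : ∀ y → f.to (f⁻¹.to y) ≡ y
    ff⁻¹ = proj₂ inverse

    f⁻¹f : ∀ x → f⁻¹.to (f.to x) ≡ x
    f⁻¹f x = f.injective (ff⁻¹ (f.to x))

    conj : X ↪ X → Y ↪ Y
    conj p = f ∘↪ p ∘↪ f⁻¹

    conj-mono : ∀ {p p′} → Poset._≤_ (ℙ X) p p′ →
                Poset._≤_ (ℙ Y) (conj p) (conj p′)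
    conj-mono {p} {p′} p⊆p′ (y , refl) =
      let x , eq = p⊆p′ (f⁻¹.to y , refl)
      in f.to x , cong f.to (trans (cong (_↪_.to p′) (f⁻¹f x)) eq)

    conj-cancel : ∀ {p p′} → Poset._≤_ (ℙ Y) (conj p) (conj p′) →
                  Poset._≤_ (ℙ X) p p′
    conj-cancel {p} {p′} le (x , refl) =
      let y , eq = le (f.to x , refl)
      in f⁻¹.to y , trans (f.injective eq) (cong (_↪_.to p) (f⁻¹f x))

  ⇄⇒idealEmbedding : ExcludedMiddle ℓ → X ⇄ Y →
    (𝔹 : BooleanCompletion (sq (ℙ X))) (ℂ : BooleanCompletion (sq (ℙ Y))) →
    IdealEmbedding (BooleanCompletion.algebra 𝔹) (BooleanCompletion.algebra ℂ)
  ⇄⇒idealEmbedding em (f , g) 𝔹 ℂ = common-extension⇒idealEmbedding em (ℙ X) (ℙ Y) 𝔹 ℂ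
    _⊆_ (λ a b c → b (a c))
    (λ p → image (f.to ∘ _↪_.to p)) (λ q → image (_↪_.to q))
    (image-∘-mono f.to) (image-∘-cancel f.injective) id id
    -- `f[p[g[Y]]]` is a copy of `Y` inside `f[p[X]]`.
    (λ p → f ∘↪ p ∘↪ g , λ { (y , refl) → _ , refl })
    λ {p} {q} q⊆fp →
      -- Write `q` as `f ∘ p ∘ u` with `u : Y ↪ X`; then `p ∘ u ∘ f` is a self-embedding of `X`
      -- whose copy `f` sends to `q[f[X]]`, inside `q[Y]`.
      let u , fpu≡q = factor q (f ∘↪ p) q⊆fp
      in p ∘↪ u ∘↪ f , λ { (x , refl) → f.to x , sym (fpu≡q (f.to x)) }
    where
    module f = _↪_ f

theorem2p10 : ∀ {ℓ} {L : Language ℓ} (X Y : Structure L) →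
    (X ≅ Y → ℙ X ≅ᴾ ℙ Y)
    × (ExcludedMiddle ℓ → X ⇄ Y →
    (B : BooleanCompletion (sq (ℙ X))) (C : BooleanCompletion (sq (ℙ Y))) →
    BooleanCompletion.algebra B ≅ᴮ BooleanCompletion.algebra C)
theorem2p10 X Y = ≅⇒ℙ≅ℙ , λ em (f , g) B C →
  cantor-bernstein (BooleanCompletion.isComplete B)
    (⇄⇒idealEmbedding em (f , g) B C) (⇄⇒idealEmbedding em (g , f) C B)
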